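{- Let $h\geqslant 0$ be an integer and let $G$ be a super-$\lambda^{(h)}$ graph. Then $\rho^{(h)}(G)\leqslant \delta(G)-1$, where $\delta(G)$ is the minimum vertex-degree of $G$.
   Context: All graphs are finite and simple. For a connected graph $G=(V,E)$ and an integer $h\geqslant 0$, a set $F\subseteq E(G)$ is an $h$-extra edge-cut if $G-F$ is disconnected and every component of $G-F$ has more than $h$ vertices. If such a set exists, $\lambda^{(h)}(G)$ is the minimum cardinality of an $h$-extra edge-cut, and $G$ is called a $\lambda^{(h)}$-graph (or $\lambda^{(h)}$-connected); otherwise $\lambda^{(h)}(G)$ does not exist. A $\lambda^{(h)}$-cut is an $h$-extra edge-cut of cardinality $\lambda^{(h)}(G)$. For $X\subset V(G)$, $d_G(X)$ is the number of edges between $X$ and $V(G)\setminus X$, and $\xi_h(G)=\min\{d_G(X): X\subset V(G),\ |X|=h+1,\ G[X]\text{ connected}\}$. A $\lambda^{(h)}$-graph $G$ is $\lambda^{(h)}$-optimal if $\lambda^{(h)}(G)=\xi_h(G)$. A $\lambda^{(h)}$-optimal graph $G$ is super-$\lambda^{(h)}$ if every $\lambda^{(h)}$-cut $F$ of $G$ isolates at least one connected subgraph of order $h+1$, i.e. some component of $G-F$ has exactly $h+1$ vertices. These notions apply to connected graphs only; a disconnected graph is not super-$\lambda^{(h)}$. For a super-$\lambda^{(h)}$ graph $G$, the persistence $\rho^{(h)}(G)$ is the maximum integer $m$ such that $G-F$ is still super-$\lambda^{(h)}$ for every $F\subseteq E(G)$ with $|F|\leqslant m$. -}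

module Defs where

open import Data.Bool using (Bool; false; T; _∧_; _xor_; not)
open import Data.Nat using (ℕ; suc; _≤_; _<_; _<ᵇ_)
open import Data.Fin using (Fin; toℕ)
open import Data.Fin.Subset using (Subset; _∈_; _⊆_; _⊂_; ∣_∣; Nonempty; ⊤)
open import Data.List using (List; length; filterᵇ; cartesianProduct; allFin)
open import Data.Vec using (lookup; tabulate)
open import Data.Product using (_×_; _,_; ∃-syntax)
open import Relation.Binary using (Rel)
open import Relation.Binary.Construct.Closure.ReflexiveTransitive using (Star)
open import Relation.Binary.PropositionalEquality using (_≡_; cong; cong₂)
open import Relation.Nullary using (¬_)
open import Level using (0ℓ)

IsMinimum : (ℕ → Set) → ℕ → Set
IsMinimum P m = P m × (∀ k → P k → m ≤ k)

IsMaximum : (ℕ → Set) → ℕ → Set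
IsMaximum P m = P m × (∀ k → P k → k ≤ m)

-- A finite simple graph with vertex set Fin n.
-- A set of edges F ⊆ E(G) is encoded by the spanning subgraph (V(G) , F),
-- so edge sets are also elements of Graph n.
record Graph (n : ℕ) : Set where
  field
    adj       : Fin n → Fin n → Bool
    symmetric : ∀ u v → adj u v ≡ adj v u
    loopless  : ∀ v → adj v v ≡ false

  Adj : Rel (Fin n) 0ℓ
  Adj u v = T (adj u v)

  -- Each edge {u , v} is listed once, as the pair with u < v.
  edges : List (Fin n × Fin n)
  edges = filterᵇ (λ (u , v) → (toℕ u <ᵇ toℕ v) ∧ adj u v)
                  (cartesianProduct (allFin n) (allFin n))

  size : ℕ
  size = length edges

  degree : Fin n → ℕ
  degree v = ∣ tabulate (adj v) ∣

  -- d_G(X), the number of edges between X and its complement.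
  boundary : Subset n → ℕ
  boundary X = length (filterᵇ (λ (u , v) → lookup X u xor lookup X v) edges)

open Graph public

private variable
  n : ℕ

_⊆ᴱ_ : Graph n → Graph n → Set
F ⊆ᴱ G = ∀ u v → Adj F u v → Adj G u v

_∖ᴱ_ : Graph n → Graph n → Graph n
(G ∖ᴱ F) .adj u v = adj G u v ∧ not (adj F u v)
(G ∖ᴱ F) .symmetric u v =
  cong₂ (λ a b → a ∧ not b) (symmetric G u v) (symmetric F u v)
(G ∖ᴱ F) .loopless v = cong (_∧ not (adj F v v)) (loopless G v)

IsMinDegree : Graph n → ℕ → Set
IsMinDegree G = IsMinimum (λ d → ∃[ v ] degree G v ≡ d)

-- The induced subgraph G[X] is connected: it has a vertex, and any two of its
-- vertices are joined by a walk that stays inside X.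
InducesConnected : Graph n → Subset n → Set
InducesConnected G X =
  Nonempty X ×
  (∀ u v → u ∈ X → v ∈ X → Star (λ x y → x ∈ X × y ∈ X × Adj G x y) u v)

Connected : Graph n → Set
Connected G = InducesConnected G ⊤

-- C is the vertex set of a component, i.e. of a maximal connected subgraph.
IsComponent : Graph n → Subset n → Set
IsComponent G C =
  InducesConnected G C × (∀ D → InducesConnected G D → C ⊆ D → D ⊆ C)

IsExtraEdgeCut : ℕ → Graph n → Graph n → Set
IsExtraEdgeCut h G F =
  F ⊆ᴱ G ×
  ¬ Connected (G ∖ᴱ F) ×
  (∀ C → IsComponent (G ∖ᴱ F) C → h < ∣ C ∣)

-- λ⁽ʰ⁾(G) exists and equals k.
IsExtraEdgeConnectivity : ℕ → Graph n → ℕ → Set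
IsExtraEdgeConnectivity h G =
  IsMinimum (λ k → ∃[ F ] (IsExtraEdgeCut h G F × size F ≡ k))

-- ξ_h(G) exists and equals k.
IsMinBoundary : ℕ → Graph n → ℕ → Set
IsMinBoundary h G =
  IsMinimum (λ k → ∃[ X ] (X ⊂ ⊤ × ∣ X ∣ ≡ suc h × InducesConnected G X
                           × boundary G X ≡ k))

-- F is a λ⁽ʰ⁾-cut.
IsMinimumExtraEdgeCut : ℕ → Graph n → Graph n → Set
IsMinimumExtraEdgeCut h G F =
  IsExtraEdgeCut h G F × IsExtraEdgeConnectivity h G (size F)

-- λ⁽ʰ⁾-optimality; in particular G is connected and λ⁽ʰ⁾(G) exists.
Optimal : ℕ → Graph n → Set
Optimal h G =
  Connected G × ∃[ k ] (IsExtraEdgeConnectivity h G k × IsMinBoundary h G k)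

Super : ℕ → Graph n → Set
Super h G =
  Optimal h G ×
  (∀ F → IsMinimumExtraEdgeCut h G F →
    ∃[ C ] (IsComponent (G ∖ᴱ F) C × ∣ C ∣ ≡ suc h))

-- ρ⁽ʰ⁾(G) equals m; meant for super-λ⁽ʰ⁾ graphs G, for which m = 0 always
-- qualifies, so that ranging over ℕ instead of ℤ loses nothing.
IsPersistence : ℕ → Graph n → ℕ → Set
IsPersistence h G =
  IsMaximum (λ m → ∀ F → F ⊆ᴱ G → size F ≤ m → Super h (G ∖ᴱ F))

{-# OPTIONS --safe #-}

-- Deleting all edges at a vertex v of minimum degree removes δ(G) edges and
-- isolates v. The remaining graph is not super: it is either disconnected, or
-- has v as its only vertex, and then no edge set disconnects it.

module Submission where

open import Data.Nat using (ℕ)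
open import Data.Integer using (+_; _-_; _≤_)
open import Defs

open import Data.Bool using (T; _∧_; _∨_)
open import Data.Bool.Properties using (∨-comm; T-≡; T-∧; T-∨; T-not-≡; T?)
open import Data.Fin using (Fin; toℕ; _≟_)
open import Data.Fin.Subset using (Subset; _∈_; ∣_∣)
open import Data.Fin.Subset.Properties using (∈⊤; x∈p∧x≢y⇒x∈p-y; x∈p⇒∣p-x∣<∣p∣)
open import Data.Integer using (+≤+)
open import Data.List using (List; []; _∷_; length; cartesianProduct; allFin)
import Data.List.Membership.Propositional as List
open import Data.List.Membership.Propositional.Properties using (∈-filter⁻)
open import Data.List.Relation.Unary.All as All using ()
open import Data.List.Relation.Unary.AllPairs using (_∷_)
open import Data.List.Relation.Unary.Any using (here; there)
open import Data.List.Relation.Unary.Unique.Propositional using (Unique)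
import Data.List.Relation.Unary.Unique.Propositional.Properties as Unique
import Data.Nat as ℕ
import Data.Nat.Properties as ℕ
open import Data.Product using (_×_; _,_; proj₁; proj₂)
open import Data.Sum as Sum using (_⊎_; inj₁; inj₂)
open import Data.Vec using (tabulate)
open import Data.Vec.Properties using (lookup⇒[]=; lookup∘tabulate)
open import Function using (_∘_; Equivalence)
open import Relation.Binary.Construct.Closure.ReflexiveTransitive using (Star; ε; _◅_)
open import Relation.Binary.PropositionalEquality
  using (_≡_; refl; sym; trans; cong; cong₂; subst)
open import Relation.Nullary using (¬_; yes; no; contradiction)
open import Relation.Nullary.Decidable using (⌊_⌋; toWitness; fromWitness)

open Equivalence using (to; from)

private variable
  n : ℕ

-- Induction on the list: no later element shares the image of the head `x`, so the tail maps into
-- `S` with `f x` removed, a strictly smaller set. Injectivity is asked only on members of `xs`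
-- because `otherEnd v` has it only on edges at `v`.
injective⇒length≤∣S∣ : {A : Set} (S : Subset n) (f : A → Fin n) {xs : List A} → Unique xs →
  (∀ {x} → x List.∈ xs → f x ∈ S) →
  (∀ {x y} → x List.∈ xs → y List.∈ xs → f x ≡ f y → x ≡ y) →
  length xs ℕ.≤ ∣ S ∣
injective⇒length≤∣S∣ S f {[]} _ _ _ = ℕ.z≤n
injective⇒length≤∣S∣ S f {x ∷ xs} (x∉xs ∷ unique) f∈S injective =
  ℕ.≤-<-trans
    (injective⇒length≤∣S∣ _ f unique
      (λ y∈xs → x∈p∧x≢y⇒x∈p-y (f∈S (there y∈xs))
        (λ fy≡fx → All.lookup x∉xs y∈xs (injective (here refl) (there y∈xs) (sym fy≡fx))))
      (λ y∈xs z∈xs → injective (there y∈xs) (there z∈xs)))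
    (x∈p⇒∣p-x∣<∣p∣ (f∈S (here refl)))

edges-unique : (G : Graph n) → Unique (edges G)
edges-unique {n} G =
  Unique.filter⁺ _ (Unique.cartesianProduct⁺ (Unique.allFin⁺ n) (Unique.allFin⁺ n))

∈-edges⁻ : (G : Graph n) {u w : Fin n} → (u , w) List.∈ edges G →
  toℕ u ℕ.< toℕ w × Adj G u w
∈-edges⁻ {n} G {u} {w} e∈ =
  let u<w , uw = to T-∧ (proj₂ (∈-filter⁻ (T? ∘ λ (u , w) → (toℕ u ℕ.<ᵇ toℕ w) ∧ adj G u w)
                                          {xs = cartesianProduct (allFin n) (allFin n)} e∈))
  in ℕ.<ᵇ⇒< _ _ u<w , uw

∈-neighbours : (G : Graph n) {v w : Fin n} → Adj G v w → w ∈ tabulate (adj G v)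
∈-neighbours G {v} {w} vw =
  lookup⇒[]= w _ (trans (lookup∘tabulate (adj G v) w) (to T-≡ vw))

Adj-sym : (G : Graph n) {u v : Fin n} → Adj G u v → Adj G v u
Adj-sym G {u} {v} = subst T (symmetric G u v)

star : Graph n → Fin n → Graph n
star G v .adj x y = adj G x y ∧ (⌊ x ≟ v ⌋ ∨ ⌊ y ≟ v ⌋)
star G v .symmetric x y = cong₂ _∧_ (symmetric G x y) (∨-comm ⌊ x ≟ v ⌋ ⌊ y ≟ v ⌋)
star G v .loopless x = cong (_∧ (⌊ x ≟ v ⌋ ∨ ⌊ x ≟ v ⌋)) (loopless G x)

star-adj⁻ : (G : Graph n) {v x y : Fin n} → Adj (star G v) x y →
  Adj G x y × (x ≡ v ⊎ y ≡ v)
star-adj⁻ G {v} {x} {y} xy =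
  let Gxy , end = to T-∧ xy
  in Gxy , Sum.map (toWitness {a? = x ≟ v}) (toWitness {a? = y ≟ v}) (to T-∨ end)

star-adj⁺ : (G : Graph n) {v w : Fin n} → Adj G v w → Adj (star G v) v w
star-adj⁺ G {v} vw = from T-∧ (vw , from T-∨ (inj₁ (fromWitness {a? = v ≟ v} refl)))

star⊆ : (G : Graph n) (v : Fin n) → star G v ⊆ᴱ G
star⊆ G v x y xy = proj₁ (star-adj⁻ G xy)

-- Meaningful for pairs that contain `v`; on any other pair the first entry is a mere default.
otherEnd : Fin n → Fin n × Fin n → Fin n
otherEnd v (u , w) with u ≟ v
... | yes _ = w
... | no  _ = u

-- Sending each edge at `v` to its other end injects the star into the neighbourhood of `v`. An
-- upper bound suffices, since persistence covers every edge set of size at most `ρ`.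
star-size : (G : Graph n) (v : Fin n) → size (star G v) ℕ.≤ degree G v
star-size {n} G v =
  injective⇒length≤∣S∣ (tabulate (adj G v)) (otherEnd v) (edges-unique (star G v))
    (λ e∈ → ∈-neighbours G (neighbour (proj₂ (∈-edges⁻ (star G v) e∈))))
    (λ e∈ e′∈ → injective (∈-edges⁻ (star G v) e∈) (∈-edges⁻ (star G v) e′∈))
  where
  neighbour : ∀ {u w} → Adj (star G v) u w → Adj G v (otherEnd v (u , w))
  neighbour {u} {w} uw with u ≟ v | star-adj⁻ G uw
  ... | yes refl | Guw , _         = Guw
  ... | no u≢v   | _   , inj₁ u≡v  = contradiction u≡v u≢v
  ... | no _     | Guw , inj₂ refl = Adj-sym G Guw

  -- The orientation u < w decides whether v is the first or the second end.
  injective : ∀ {a b c d} →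
    toℕ a ℕ.< toℕ b × Adj (star G v) a b → toℕ c ℕ.< toℕ d × Adj (star G v) c d →
    otherEnd v (a , b) ≡ otherEnd v (c , d) → (a , b) ≡ (c , d)
  injective {a} {b} {c} {d} (a<b , ab) (c<d , cd) eq
    with a ≟ v | c ≟ v | proj₂ (star-adj⁻ G ab) | proj₂ (star-adj⁻ G cd)
  ... | yes refl | yes refl | _         | _         = cong (a ,_) eq
  ... | no a≢v   | _        | inj₁ a≡v  | _         = contradiction a≡v a≢v
  ... | _        | no c≢v   | _         | inj₁ c≡v  = contradiction c≡v c≢v
  ... | no _     | no _     | inj₂ refl | inj₂ refl = cong (_, b) eq
  ... | yes refl | no _     | _         | inj₂ refl rewrite eq = contradiction a<b (ℕ.<-asym c<d)
  ... | no _     | yes refl | inj₂ refl | _         rewrite eq = contradiction a<b (ℕ.<-asym c<d)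

star-isolates : (G : Graph n) (v w : Fin n) → ¬ Adj (G ∖ᴱ star G v) v w
star-isolates G v w vw =
  let Gvw , ¬star = to (T-∧ {adj G v w}) vw
  in subst T (to T-not-≡ ¬star) (star-adj⁺ G Gvw)

-- A super graph is connected and has an extra edge-cut `F`. Connectedness forces an isolated `v` to
-- be the only vertex, and a graph on one vertex stays connected after deleting `F`.
isolated⇒¬super : (h : ℕ) (G : Graph n) (v : Fin n) → (∀ w → ¬ Adj G v w) → ¬ Super h G
isolated⇒¬super h G v isolated
  ((connected , _ , ((F , (_ , disconnected , _) , _) , _) , _) , _) =
  -- All vertices equal `v`, so the empty walk joins any two of them.
  disconnected ((v , ∈⊤) , λ x y _ _ → subst (Star _ x) (trans (sym (v≡ x)) (v≡ y)) ε)
  where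
  v≡ : ∀ w → v ≡ w
  -- A nonempty walk from `v` would start with an edge at `v`.
  v≡ w with proj₂ connected v w ∈⊤ ∈⊤
  ... | ε                = refl
  ... | (_ , _ , vx) ◅ _ = contradiction vx (isolated _)

theorem1p6 : (n h : ℕ) (G : Graph n) → Super h G →
    (ρ δ : ℕ) → IsPersistence h G ρ → IsMinDegree G δ →
    + ρ ≤ + δ - + 1
-- Matching `refl` turns `δ` into the degree of `v`. If `δ ≤ ρ`, the star at `v` is small enough for
-- persistence to apply.
theorem1p6 n h G _ ρ δ (persists , _) ((v , refl) , _) = <⇒≤-1 (ℕ.≰⇒> λ δ≤ρ →
  isolated⇒¬super h (G ∖ᴱ star G v) v (star-isolates G v)
    (persists (star G v) (star⊆ G v) (ℕ.≤-trans (star-size G v) δ≤ρ)))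
  where
  <⇒≤-1 : ∀ {k m} → k ℕ.< m → + k ≤ + m - + 1
  -- The match exposes the larger number as a successor, so the integer subtraction computes to its
  -- predecessor; this also excludes `δ = 0`.
  <⇒≤-1 (ℕ.s≤s k≤m) = +≤+ k≤m
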